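{- Let $H$ be a fixed graph without isolated vertices. If \[ e(H) > 2v(H) - \alpha(H), \] then \[ \mathrm{TR}(qH) > \mathrm{R}(qH) \] for every sufficiently large integer $q$.
   Context: Graphs are finite, simple, and have at least one vertex. For a graph $G$, $v(G)$ denotes its number of vertices, $e(G)$ its number of edges, and $\alpha(G)$ its independence number. For a positive integer $q$ and a graph $H$, $qH$ denotes the disjoint union of $q$ copies of $H$. For a graph $G$ without isolated vertices, $\mathrm{R}(G)$ denotes the diagonal Ramsey number: the least integer $n$ such that every red--blue colouring of the edges of the complete graph $K_n$ contains a monochromatic copy of $G$ (as a not necessarily induced subgraph). Let $G$ be a graph without isolated vertices and $m = e(G)$. In a red--blue edge-coloured complete graph, a Ramsey chain with target graph $G$ is a sequence $G_1, G_2, \ldots, G_m$ of pairwise edge-disjoint monochromatic subgraphs (each $G_i$ is monochromatic, but different $G_i$ may have different colours) such that $e(G_i) = i$ for all $i$, $G_i$ is isomorphic to a subgraph of $G_{i+1}$ for $1 \leq i < m$, and $G_m \cong G$. The target Ramsey number $\mathrm{TR}(G)$ is the least integer $n$ such that every red--blue colouring of the edges of $K_n$ contains a Ramsey chain with target $G$. It is known (Chartrand and Zhang) that $\mathrm{TR}(G)$ exists for every graph $G$ without isolated vertices. -}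

module Defs where

open import Data.Fin using (Fin; toℕ; remQuot; _<?_) renaming (zero to fzero; suc to fsuc)
import Data.Fin.Properties as Fin
open import Data.Fin.Subset using (Subset; inside; outside; ∣_∣; _∈_)
open import Data.Fin.Subset.Properties using (_∈?_)
open import Data.List using (List; []; _∷_; _++_; map; filter; length; allFin; cartesianProduct)
open import Data.List.Extrema.Nat using (max)
open import Data.Nat using (ℕ; zero; suc; _*_; _≤_)
open import Data.Product using (Σ; ∃-syntax; _×_; _,_; proj₁; proj₂)
import Data.Vec as Vec
open import Function.Base using (_∘_)
open import Function.Bundles using (_↔_; _⇔_; Inverse)
open import Level using (0ℓ)
open import Relation.Binary using (Rel; Decidable; Symmetric; Irreflexive)
open import Relation.Binary.PropositionalEquality using (_≡_; _≢_; sym; cong)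
open import Relation.Nullary using (¬_; Dec; ¬?; _×-dec_; _→-dec_)

-- The order is allowed to be zero here; statements about graphs with at
-- least one vertex say so by a separate NonZero assumption.
record Graph : Set₁ where
  field
    order   : ℕ
    Adj     : Rel (Fin order) 0ℓ
    adj?    : Decidable Adj
    symm    : Symmetric Adj
    irrefl  : Irreflexive _≡_ Adj

open Graph public

v : Graph → ℕ
v = order

-- Each edge {i , j} is listed once, as the pair with i < j.
edges : (G : Graph) → List (Fin (v G) × Fin (v G))
edges G = filter (λ (i , j) → i <? j ×-dec adj? G i j)
                 (cartesianProduct (allFin (v G)) (allFin (v G)))

e : Graph → ℕ
e = length ∘ edges

NoIsolatedVertices : Graph → Set
NoIsolatedVertices G = ∀ x → ∃[ y ] Adj G x y

Independent : (G : Graph) → Subset (v G) → Set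
Independent G S = ∀ x y → x ∈ S → y ∈ S → ¬ Adj G x y

independent? : (G : Graph) (S : Subset (v G)) → Dec (Independent G S)
independent? G S = Fin.all? λ x → Fin.all? λ y →
  (x ∈? S) →-dec ((y ∈? S) →-dec ¬? (adj? G x y))

subsets : ∀ n → List (Subset n)
subsets zero    = Vec.[] ∷ []
subsets (suc n) = map (inside Vec.∷_) (subsets n) ++ map (outside Vec.∷_) (subsets n)

α : Graph → ℕ
α G = max 0 (map ∣_∣ (filter (independent? G) (subsets (v G))))

K : ℕ → Graph
K n = record
  { order  = n
  ; Adj    = _≢_
  ; adj?   = λ x y → ¬? (x Fin.≟ y)
  ; symm   = λ x≢y y≡x → x≢y (sym y≡x)
  ; irrefl = λ x≡y x≢y → x≢y x≡y
  }

-- The vertex (a , i) of the disjoint union, vertex i of the a-th copy,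
-- is encoded as combine a i.
copies : ℕ → Graph → Graph
copies q H = record
  { order  = q * v H
  ; Adj    = λ x y → copy x ≡ copy y × Adj H (vertex x) (vertex y)
  ; adj?   = λ x y → (copy x Fin.≟ copy y) ×-dec adj? H (vertex x) (vertex y)
  ; symm   = λ (same , adj) → sym same , symm H adj
  ; irrefl = λ x≡y (_ , adj) → irrefl H (cong vertex x≡y) adj
  }
  where
  copy : Fin (q * v H) → Fin q
  copy = proj₁ ∘ remQuot (v H)

  vertex : Fin (q * v H) → Fin (v H)
  vertex = proj₂ ∘ remQuot {q} (v H)

record _≅_ (G F : Graph) : Set where
  field
    bijection : Fin (v G) ↔ Fin (v F)
    adj⇔      : ∀ x y → Adj G x y ⇔ Adj F (Inverse.to bijection x) (Inverse.to bijection y)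

record Subgraph (G : Graph) : Set₁ where
  field
    verts  : Subset (v G)
    Edge   : Rel (Fin (v G)) 0ℓ
    edge?  : Decidable Edge
    symmᵉ  : Symmetric Edge
    edge⇒∈ : ∀ {x y} → Edge x y → x ∈ verts
    edge⇒adj : ∀ {x y} → Edge x y → Adj G x y

open Subgraph public

-- The increasing enumeration of the elements of a subset.
element : ∀ {n} (S : Subset n) → Fin ∣ S ∣ → Fin n
element (inside  Vec.∷ S) fzero    = fzero
element (inside  Vec.∷ S) (fsuc i) = fsuc (element S i)
element (outside Vec.∷ S) i        = fsuc (element S i)

-- A subgraph as a graph in its own right, on exactly its own vertices.
⟦_⟧ : ∀ {G} → Subgraph G → Graph
⟦_⟧ {G} S = record
  { order  = ∣ verts S ∣
  ; Adj    = λ i j → Edge S (element (verts S) i) (element (verts S) j)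
  ; adj?   = λ i j → edge? S (element (verts S) i) (element (verts S) j)
  ; symm   = symmᵉ S
  ; irrefl = λ i≡j ij → irrefl G (cong (element (verts S)) i≡j) (edge⇒adj S ij)
  }

_IsIsomorphicToSubgraphOf_ : Graph → Graph → Set₁
F IsIsomorphicToSubgraphOf G = Σ (Subgraph G) λ S → F ≅ ⟦ S ⟧

data Colour : Set where
  red blue : Colour

-- The values colour x x carry no meaning: they are never inspected, since
-- a subgraph of K n has no loops.
record Colouring (n : ℕ) : Set where
  field
    colour  : Fin n → Fin n → Colour
    colour-sym : ∀ x y → colour x y ≡ colour y x

open Colouring public

Monochromatic : ∀ {n} → Colouring n → Subgraph (K n) → Set
Monochromatic c S = ∃[ k ] (∀ {x y} → Edge S x y → colour c x y ≡ k)

HasMonochromaticCopy : ∀ {n} → Colouring n → Graph → Set₁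
HasMonochromaticCopy {n} c G =
  Σ (Subgraph (K n)) λ S → Monochromatic c S × ⟦ S ⟧ ≅ G

EdgeDisjoint : ∀ {G} → Subgraph G → Subgraph G → Set
EdgeDisjoint S T = ∀ {x y} → Edge S x y → ¬ Edge T x y

-- link i is the (toℕ i + 1)-st term of the chain.
record RamseyChain {n} (c : Colouring n) (G : Graph) : Set₁ where
  field
    link          : Fin (e G) → Subgraph (K n)
    monochromatic : ∀ i → Monochromatic c (link i)
    edgeDisjoint  : ∀ i j → i ≢ j → EdgeDisjoint (link i) (link j)
    size          : ∀ i → e ⟦ link i ⟧ ≡ suc (toℕ i)
    ascending     : ∀ i j → toℕ j ≡ suc (toℕ i) →
                    ⟦ link i ⟧ IsIsomorphicToSubgraphOf ⟦ link j ⟧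
    target        : ∀ i → suc (toℕ i) ≡ e G → ⟦ link i ⟧ ≅ G

IsLeast : (ℕ → Set₁) → ℕ → Set₁
IsLeast P n = P n × (∀ k → P k → n ≤ k)

IsRamseyNumber : Graph → ℕ → Set₁
IsRamseyNumber G = IsLeast λ n → (c : Colouring n) → HasMonochromaticCopy c G

IsTargetRamseyNumber : Graph → ℕ → Set₁
IsTargetRamseyNumber G = IsLeast λ n → (c : Colouring n) → RamseyChain c G

{-# OPTIONS --safe #-}
module Submission where

-- A Ramsey chain with target qH has m = q e(H) edge-disjoint links with
-- 1 + 2 + … + m edges in total, so K t needs m(m + 1) ≤ t(t − 1), that is t > m.
-- With d = 2 v(H) − α(H) < e(H) this gives TR(qH) > q(d + 1), and it remains to
-- see that R(qH) ≤ qd + C for a constant C (Burr, Erdős and Spencer).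
-- Call a set of at most d vertices that contains both a red and a blue H a
-- bowtie. A large red clique A disjoint from a large blue clique B yields a
-- bowtie: pass to subsets with all edges between them of one colour, say red, and
-- let a red H and a blue H overlap in α(H) vertices of B. So fix a large
-- monochromatic clique, say red, and apply Ramsey's theorem repeatedly outside it:
-- either a bowtie appears or red copies of H can be removed one after the other
-- until q of them are found. Each bowtie costs d vertices and contributes a copy
-- of H in either colour.

open import Defs
open import Data.Fin using (Fin; toℕ; combine; remQuot) renaming (zero to fzero; suc to fsuc)
import Data.Fin as Fin
import Data.Fin.Properties as Fin
open import Data.Fin.Subset using (Subset; inside; outside; ⊥; ∣_∣; _∈_)
open import Data.Fin.Subset.Properties using (_∈?_; ∣p∣≤n; ∉⊥; ∣⊥∣≡0)
open import Data.List
  using (List; []; _∷_; _++_; map; filter; length; lookup; tabulate; concat; take; drop; allFin;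
         cartesianProduct; cartesianProductWith)
open import Data.Nat.Properties
open import Data.List.Extrema ≤-totalOrder using (argmax-sel)
import Data.List.Membership.Propositional as List
open import Data.List.Membership.Propositional.Properties
open import Data.List.Properties
  using (length-++; length-map; length-tabulate; tabulate-lookup; map-tabulate; map-cong-local;
         take++drop≡id; length-take; ++-assoc; map-++)
open import Data.List.Relation.Binary.Permutation.Propositional
  using (_↭_; prep; ↭-refl; ↭-sym; ↭-trans; ↭-reflexive; ↭⇒↭ₛ)
import Data.List.Relation.Binary.Permutation.Propositional.Properties as ↭
import Data.List.Relation.Binary.Permutation.Setoid.Properties as ↭ₛ
open import Data.List.Relation.Unary.All as All using (All; []; _∷_)
import Data.List.Relation.Unary.All.Properties as All
open import Data.List.Relation.Unary.AllPairs as AllPairs using (AllPairs; []; _∷_)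
import Data.List.Relation.Unary.AllPairs.Properties as AllPairs
open import Data.List.Relation.Unary.Any as Any using (here; there)
open import Data.List.Relation.Unary.Any.Properties using (lookup-index)
open import Data.List.Relation.Unary.Unique.Propositional using (Unique)
import Data.List.Relation.Unary.Unique.Propositional.Properties as Unique
open import Data.Nat
  using (ℕ; zero; suc; z≤n; s≤s; s≤s⁻¹; _+_; _≤_; _<_; _^_; NonZero; _>_; _≥_; _*_; _∸_)
open import Data.Nat.Solver using (module +-*-Solver)
open import Data.Product using (Σ; ∃-syntax; _×_; _,_; proj₁; proj₂; swap; uncurry; map₁)
open import Data.Sum as Sum using (_⊎_; inj₁; inj₂; [_,_]′)
import Data.Vec as Vec
import Data.Vec.Properties as Vec
open import Function.Base using (_∘_; id)
open import Function.Bundles using (mk↔ₛ′; mk⇔)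
open import Relation.Binary using (Rel; Symmetric)
open import Relation.Binary.PropositionalEquality
  using (_≡_; _≢_; refl; sym; trans; cong; cong₂; subst; subst₂; resp₂; setoid;
         ≢-sym; module ≡-Reasoning)
open import Level using (0ℓ)
open import Relation.Nullary using (¬_; Dec; yes; no; does; contradiction; decidable-stable; _×-dec_)
open import Relation.Nullary.Decidable using (dec-true)
import Relation.Unary as Pred

-- Lists up to permutation, and inclusion of lists as multisets.

module _ {A : Set} where

  -- Multiset inclusion in a form that carries the complement `zs`: greedy arguments remove `xs`
  -- from `ys` and go on inside `zs`.
  _≼_ : List A → List A → Set
  xs ≼ ys = ∃[ zs ] ys ↭ xs ++ zs

  ≼-refl : ∀ {xs} → xs ≼ xs
  ≼-refl = [] , ↭-sym (↭.++-identityʳ _)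

  ≼-trans : ∀ {xs ys zs} → xs ≼ ys → ys ≼ zs → xs ≼ zs
  ≼-trans {xs} (us , p) (vs , q) =
    us ++ vs , ↭-trans q (↭-trans (↭.++⁺ʳ vs p) (↭-reflexive (++-assoc xs us vs)))

  []≼ : ∀ {xs} → [] ≼ xs
  []≼ = _ , ↭-refl

  ↭⇒≼ : ∀ {xs ys} → xs ↭ ys → xs ≼ ys
  ↭⇒≼ p = [] , ↭-trans (↭-sym p) (↭-sym (↭.++-identityʳ _))

  ++-≼ˡ : ∀ xs {ys} → xs ≼ (xs ++ ys)
  ++-≼ˡ xs = _ , ↭-refl

  ++-≼ʳ : ∀ xs {ys} → ys ≼ (xs ++ ys)
  ++-≼ʳ xs {ys} = xs , ↭.++-comm xs ys

  ∷-mono-≼ : ∀ x {xs ys} → xs ≼ ys → (x ∷ xs) ≼ (x ∷ ys)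
  ∷-mono-≼ x (us , p) = us , prep x p

  ++-monoʳ-≼ : ∀ xs {ys zs} → ys ≼ zs → (xs ++ ys) ≼ (xs ++ zs)
  ++-monoʳ-≼ []       p = p
  ++-monoʳ-≼ (x ∷ xs) p = ∷-mono-≼ x (++-monoʳ-≼ xs p)

  ++-mono-≼ : ∀ {ws xs ys zs} → ws ≼ xs → ys ≼ zs → (ws ++ ys) ≼ (xs ++ zs)
  ++-mono-≼ {ws} {xs} {ys} {zs} p q =
    ≼-trans (↭⇒≼ (↭.++-comm ws ys))
      (≼-trans (++-monoʳ-≼ ys p)
        (≼-trans (↭⇒≼ (↭.++-comm ys xs)) (++-monoʳ-≼ xs q)))

  take-≼ : ∀ n {xs : List A} → n ≤ length xs → ∃[ ys ] ys ≼ xs × length ys ≡ n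
  take-≼ n {xs} n≤ = take n xs , (drop n xs , ↭-reflexive (sym (take++drop≡id n xs)))
                   , trans (length-take n xs) (m≤n⇒m⊓n≡m n≤)

  All-≼ : ∀ {P : A → Set} {xs ys} → xs ≼ ys → All P ys → All P xs
  All-≼ {xs = xs} (_ , p) = All.++⁻ˡ xs ∘ ↭.All-resp-↭ p

  AllPairs-++⁻ˡ : ∀ {R : Rel A 0ℓ} xs {ys} → AllPairs R (xs ++ ys) → AllPairs R xs
  AllPairs-++⁻ˡ []       _        = []
  AllPairs-++⁻ˡ (x ∷ xs) (r ∷ rs) = All.++⁻ˡ xs r ∷ AllPairs-++⁻ˡ xs rs

  AllPairs-≼ : ∀ {R : Rel A 0ℓ} {xs ys} → Symmetric R → xs ≼ ys → AllPairs R ys → AllPairs R xs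
  AllPairs-≼ {R} {xs} R-sym (_ , p) =
    AllPairs-++⁻ˡ xs ∘ ↭ₛ.AllPairs-resp-↭ (setoid A) R-sym (resp₂ R) (↭⇒↭ₛ p)

  AllPairs-tabulate⁻ : ∀ {R : Rel A 0ℓ} {n} {f : Fin n → A} → Symmetric R →
                       AllPairs R (tabulate f) → ∀ {i j} → i ≢ j → R (f i) (f j)
  AllPairs-tabulate⁻ R-sym (r ∷ rs) {fzero}  {fzero}  i≢j = contradiction refl i≢j
  AllPairs-tabulate⁻ R-sym (r ∷ rs) {fzero}  {fsuc j} i≢j = All.tabulate⁻ r j
  AllPairs-tabulate⁻ R-sym (r ∷ rs) {fsuc i} {fzero}  i≢j = R-sym (All.tabulate⁻ r i)
  AllPairs-tabulate⁻ R-sym (r ∷ rs) {fsuc i} {fsuc j} i≢j =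
    AllPairs-tabulate⁻ R-sym rs (i≢j ∘ cong fsuc)

  Unique-tabulate⁻ : ∀ {n} {f : Fin n → A} → Unique (tabulate f) → ∀ {i j} → f i ≡ f j → i ≡ j
  Unique-tabulate⁻ f! {i} {j} eq =
    decidable-stable (i Fin.≟ j) λ i≢j → AllPairs-tabulate⁻ ≢-sym f! i≢j eq

  Unique-++⇒≢ : ∀ {xs ys : List A} → Unique (xs ++ ys) →
                ∀ {x y} → x List.∈ xs → y List.∈ ys → x ≢ y
  Unique-++⇒≢ {x ∷ xs} (x≢ ∷ _)  (here refl) y∈ = All.lookup (All.++⁻ʳ xs x≢) y∈
  Unique-++⇒≢          (_ ∷ xs!) (there x∈)  y∈ = Unique-++⇒≢ xs! x∈ y∈

  enumerate : ∀ {n} (xs : List A) → length xs ≡ n → ∃[ f ] tabulate {n = n} f ≡ xs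
  enumerate xs refl = lookup xs , tabulate-lookup xs

  length-rest : ∀ {m n} {W : List A} xs {ys} → W ↭ xs ++ ys → length xs ≤ m →
                m + n ≤ length W → n ≤ length ys
  length-rest {m} {n} {W} xs {ys} p xs≤m h = +-cancelˡ-≤ m n (length ys) (begin
    m + n                  ≤⟨ h ⟩
    length W               ≡⟨ trans (↭.↭-length p) (length-++ xs) ⟩
    length xs + length ys  ≤⟨ +-monoˡ-≤ (length ys) xs≤m ⟩
    m + length ys          ∎)
    where open ≤-Reasoning

  -- Sending each index of `xs` to a position of its entry in `ys` is injective, because `xs` has no
  -- repetitions. All cardinality comparisons of vertex and edge sets below rest on this.
  Unique-⊆⇒length≤ : ∀ {xs ys : List A} → Unique xs → (∀ {x} → x List.∈ xs → x List.∈ ys) →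
                     length xs ≤ length ys
  Unique-⊆⇒length≤ {xs} {ys} xs! xs⊆ys = Fin.injective⇒≤ {f = position} λ {i} {j} eq →
    Unique-tabulate⁻ (subst Unique (sym (tabulate-lookup xs)) xs!)
      (trans (lookup-index (xs⊆ys (∈-lookup i)))
        (trans (cong (lookup ys) eq) (sym (lookup-index (xs⊆ys (∈-lookup j))))))
    where
    position : Fin (length xs) → Fin (length ys)
    position i = Any.index (xs⊆ys (∈-lookup i))

  split : ∀ {P : A → Set} → Pred.Decidable P → ∀ xs →
          ∃[ ys ] ∃[ zs ] xs ↭ ys ++ zs × All P ys × All (¬_ ∘ P) zs
  split P? [] = [] , [] , ↭-refl , [] , []
  split P? (x ∷ xs) with P? x | split P? xs
  ... | yes px | ys , zs , p , pys , pzs = x ∷ ys , zs , prep x p , px ∷ pys , pzs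
  ... | no ¬px | ys , zs , p , pys , pzs =
    ys , x ∷ zs , ↭-trans (prep x p) (↭-sym (↭.shift x ys zs)) , pys , ¬px ∷ pzs

-- The two colours and the majority colour of a list.

_≟ᶜ_ : (κ κ′ : Colour) → Dec (κ ≡ κ′)
red  ≟ᶜ red  = yes refl
red  ≟ᶜ blue = no λ ()
blue ≟ᶜ red  = no λ ()
blue ≟ᶜ blue = yes refl

two-colours : {κ κ′ : Colour} → κ ≢ κ′ → ∀ χ → χ ≡ κ ⊎ χ ≡ κ′
two-colours {red}  {red}  κ≢κ′ χ    = contradiction refl κ≢κ′
two-colours {blue} {blue} κ≢κ′ χ    = contradiction refl κ≢κ′
two-colours {red}  {blue} κ≢κ′ red  = inj₁ refl
two-colours {red}  {blue} κ≢κ′ blue = inj₂ refl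
two-colours {blue} {red}  κ≢κ′ red  = inj₂ refl
two-colours {blue} {red}  κ≢κ′ blue = inj₁ refl

other-colour : (κ : Colour) → ∃[ κ′ ] κ ≢ κ′
other-colour red  = blue , λ ()
other-colour blue = red , λ ()

-- Two colour classes with fewer than m members each have at most 2m - 2 members together, so 2m - 1
-- entries suffice. The `suc` pays for the vertex whose neighbours are being split in `ramsey`.
majority : ∀ {A : Set} (χ : A → Colour) m xs → m + m ≤ suc (length xs) →
           ∃[ κ ] ∃[ ys ] ys ≼ xs × m ≤ length ys × All (λ y → χ y ≡ κ) ys
majority χ m xs m+m≤ with split (λ x → χ x ≟ᶜ red) xs
... | rs , bs , p , reds , ¬reds with m ≤? length rs
...   | yes m≤ = red , rs , (bs , p) , m≤ , reds
...   | no m≰  = blue , bs , ≼-trans (++-≼ʳ rs) (↭⇒≼ (↭-sym p)) , m≤ , All.map ≢red⇒≡blue ¬reds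
  where
  open ≤-Reasoning
  ≢red⇒≡blue : {κ : Colour} → κ ≢ red → κ ≡ blue
  ≢red⇒≡blue {red}  κ≢red = contradiction refl κ≢red
  ≢red⇒≡blue {blue} _     = refl
  m≤ : m ≤ length bs
  m≤ = +-cancelˡ-≤ m m (length bs) (begin
    m + m                      ≤⟨ m+m≤ ⟩
    suc (length xs)            ≡⟨ cong suc (trans (↭.↭-length p) (length-++ rs)) ⟩
    suc (length rs) + length bs ≤⟨ +-monoˡ-≤ (length bs) (≰⇒> m≰) ⟩
    m + length bs              ∎)

2^suc : ∀ n → 2 ^ suc n ≡ 2 ^ n + 2 ^ n
2^suc n = cong (2 ^ n +_) (+-identityʳ (2 ^ n))

-- Maximum independent sets and the enumeration of subsets.

max-independent : ∀ H → ∃[ S ] Independent H S × ∣ S ∣ ≡ α H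
max-independent H with argmax-sel id 0 (map ∣_∣ (filter (independent? H) (subsets (v H))))
-- The maximum may be the default value 0, which the empty set attains.
... | inj₁ α≡0 = ⊥ , (λ _ _ x∈ _ → contradiction x∈ ∉⊥) , trans (∣⊥∣≡0 (v H)) (sym α≡0)
... | inj₂ α∈ with ∈-map⁻ ∣_∣ α∈
...   | S , S∈ , α≡∣S∣ = S , proj₂ (∈-filter⁻ (independent? H) {xs = subsets (v H)} S∈) , sym α≡∣S∣

element∈ : ∀ {n} (S : Subset n) i → element S i ∈ S
element∈ (inside  Vec.∷ S) fzero    = Vec.here
element∈ (inside  Vec.∷ S) (fsuc i) = Vec.there (element∈ S i)
element∈ (outside Vec.∷ S) i        = Vec.there (element∈ S i)

element-mono-< : ∀ {n} (S : Subset n) {i j} → i Fin.< j → element S i Fin.< element S j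
element-mono-< (inside  Vec.∷ S) {fzero}  {fsuc j} i<j       = s≤s z≤n
element-mono-< (inside  Vec.∷ S) {fsuc i} {fsuc j} (s≤s i<j) = s≤s (element-mono-< S i<j)
element-mono-< (outside Vec.∷ S) i<j                         = s≤s (element-mono-< S i<j)

element-injective : ∀ {n} (S : Subset n) {i j} → element S i ≡ element S j → i ≡ j
element-injective (inside  Vec.∷ S) {fzero}  {fzero}  eq = refl
element-injective (inside  Vec.∷ S) {fsuc i} {fsuc j} eq =
  cong fsuc (element-injective S (Fin.suc-injective eq))
element-injective (outside Vec.∷ S) eq = element-injective S (Fin.suc-injective eq)

rank : ∀ {n} {S : Subset n} {x} → x ∈ S → ∃[ i ] element S i ≡ x
rank {S = inside  Vec.∷ S} Vec.here = fzero , refl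
rank {S = inside  Vec.∷ S} (Vec.there x∈) = let i , eq = rank x∈ in fsuc i , cong fsuc eq
rank {S = outside Vec.∷ S} (Vec.there x∈) = let i , eq = rank x∈ in i , cong fsuc eq

-- The entries of `element S` are distinct and all lie in `xs`, so at most n ∸ ∣S∣ vertices are left
-- for `ys`.
split-subset : ∀ {n} (S : Subset n) →
               ∃[ xs ] ∃[ ys ] allFin n ↭ xs ++ ys × All (_∈ S) xs × All (λ x → ¬ x ∈ S) ys ×
                               length ys ≤ n ∸ ∣ S ∣
split-subset {n} S with split (_∈? S) (allFin n)
... | xs , ys , p , xs⊆S , ys⊆∁S = xs , ys , p , xs⊆S , ys⊆∁S , (begin
    length ys                          ≡⟨ m+n∸m≡n (length xs) (length ys) ⟨
    length xs + length ys ∸ length xs  ≡⟨ cong (_∸ length xs) (trans (↭.↭-length p) (length-++ xs)) ⟨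
    length (allFin n) ∸ length xs      ≡⟨ cong (_∸ length xs) (length-tabulate id) ⟩
    n ∸ length xs                      ≤⟨ ∸-monoʳ-≤ n ∣S∣≤ ⟩
    n ∸ ∣ S ∣                          ∎)
  where
  open ≤-Reasoning
  elements : List (Fin n)
  elements = tabulate (element S)
  elements⊆xs : ∀ {x} → x List.∈ elements → x List.∈ xs
  elements⊆xs x∈ with ∈-tabulate⁻ x∈
  ... | i , refl with ∈-++⁻ xs (↭.∈-resp-↭ p (∈-allFin (element S i)))
  ...   | inj₁ ∈xs = ∈xs
  ...   | inj₂ ∈ys = contradiction (element∈ S i) (All.lookup ys⊆∁S ∈ys)
  ∣S∣≤ : ∣ S ∣ ≤ length xs
  ∣S∣≤ = begin
    ∣ S ∣            ≡⟨ length-tabulate (element S) ⟨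
    length elements  ≤⟨ Unique-⊆⇒length≤ (Unique.tabulate⁺ (element-injective S)) elements⊆xs ⟩
    length xs        ∎

α≤v : ∀ H → α H ≤ v H
α≤v H = let S , _ , ∣S∣≡α = max-independent H in ≤-trans (≤-reflexive (sym ∣S∣≡α)) (∣p∣≤n S)

-- The constants of the upper bound for R(qH).

bowtieSize : Graph → ℕ
bowtieSize H = 2 * v H ∸ α H

v+[v∸α]≡bowtieSize : ∀ H → v H + (v H ∸ α H) ≡ bowtieSize H
v+[v∸α]≡bowtieSize H = trans (sym (+-∸-assoc (v H) (α≤v H)))
                             (cong (λ n → v H + n ∸ α H) (sym (+-identityʳ (v H))))

v≤bowtieSize : ∀ H → v H ≤ bowtieSize H
v≤bowtieSize H = ≤-trans (m≤m+n (v H) (v H ∸ α H)) (≤-reflexive (v+[v∸α]≡bowtieSize H))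

-- Each summand covers one side of `bipartite-ramsey` with all three parameters equal to v(H), so
-- two cliques of this size satisfy both of its requirements.
cliqueSize : Graph → ℕ
cliqueSize H = v H * 2 ^ (v H + v H) + (v H + v H)

v≤cliqueSize : ∀ H → v H ≤ cliqueSize H
v≤cliqueSize H = ≤-trans (m≤m+n (v H) (v H)) (m≤n+m (v H + v H) (v H * 2 ^ (v H + v H)))

-- Room for one clique of size L = `cliqueSize H` set aside, and for the 2^(L + L) further vertices
-- that force another clique of that size.
ramseySlack : Graph → ℕ
ramseySlack H = cliqueSize H + 2 ^ (cliqueSize H + cliqueSize H)

-- Ramsey's theorem for cliques and for complete bipartite graphs.

module _ {V : Set} (χ : V → V → Colour) (χ-sym : ∀ x y → χ x y ≡ χ y x) where

  HasColour : Colour → Rel V 0ℓ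
  HasColour κ x y = χ x y ≡ κ

  HasColour-sym : ∀ {κ} → Symmetric (HasColour κ)
  HasColour-sym {κ} {x} {y} = trans (χ-sym y x)

  CliqueIn : Colour → ℕ → List V → Set
  CliqueIn κ n W = ∃[ xs ] xs ≼ W × length xs ≡ n × AllPairs (HasColour κ) xs

  CliqueIn-mono : ∀ {κ n W W′} → W ≼ W′ → CliqueIn κ n W → CliqueIn κ n W′
  CliqueIn-mono W≼W′ (xs , xs≼W , rest) = xs , ≼-trans xs≼W W≼W′ , rest

  ∷-CliqueIn : ∀ {κ n w W} → All (HasColour κ w) W → CliqueIn κ n W → CliqueIn κ (suc n) (w ∷ W)
  ∷-CliqueIn {w = w} w~W (xs , xs≼W , len , clique) =
    w ∷ xs , ∷-mono-≼ w xs≼W , cong suc len , All-≼ xs≼W w~W ∷ clique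

  -- Keep only the majority-colour neighbours of the first vertex w: the exponent drops by one, and
  -- w extends any clique of that colour found among them.
  ramsey : ∀ {κ κ′} → κ ≢ κ′ → ∀ a b W → 2 ^ (a + b) ≤ length W →
           CliqueIn κ a W ⊎ CliqueIn κ′ b W
  ramsey κ≢κ′ zero    b       W       _ = inj₁ ([] , []≼ , refl , [])
  ramsey κ≢κ′ (suc a) zero    W       _ = inj₂ ([] , []≼ , refl , [])
  ramsey κ≢κ′ (suc a) (suc b) []      h = contradiction h (<⇒≱ (m^n>0 2 (suc a + suc b)))
  ramsey κ≢κ′ (suc a) (suc b) (w ∷ W) h
    with majority (χ w) (2 ^ (a + suc b)) W (≤-trans (≤-reflexive (sym (2^suc (a + suc b)))) h)
  ... | κ″ , ys , ys≼W , large , w~ys with two-colours κ≢κ′ κ″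
  ...   | inj₁ refl = Sum.map
    (CliqueIn-mono (∷-mono-≼ w ys≼W) ∘ ∷-CliqueIn w~ys)
    (CliqueIn-mono (≼-trans ys≼W (++-≼ʳ (w ∷ []))))
    (ramsey κ≢κ′ a (suc b) ys large)
  ...   | inj₂ refl = Sum.map
    (CliqueIn-mono (≼-trans ys≼W (++-≼ʳ (w ∷ []))))
    (CliqueIn-mono (∷-mono-≼ w ys≼W) ∘ ∷-CliqueIn w~ys)
    (ramsey κ≢κ′ (suc a) b ys (≤-trans (≤-reflexive (cong (2 ^_) (sym (+-suc a b)))) large))

  record Join (κ : Colour) (k p : ℕ) (A B : List V) : Set where
    constructor join
    field
      {A′ B′}  : List V
      A′≼A     : A′ ≼ A
      B′≼B     : B′ ≼ B
      length-A′ : length A′ ≡ k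
      length-B′ : length B′ ≡ p
      joined    : All (λ b → All (HasColour κ b) A′) B′

  Join-mono : ∀ {κ k p A A₁ B B₁} → A ≼ A₁ → B ≼ B₁ → Join κ k p A B → Join κ k p A₁ B₁
  Join-mono A≼ B≼ (join A′≼A B′≼B lenA lenB joined) =
    join (≼-trans A′≼A A≼) (≼-trans B′≼B B≼) lenA lenB joined

  ∷-Join : ∀ {κ k p A b B} → All (HasColour κ b) A → Join κ k p A B → Join κ k (suc p) A (b ∷ B)
  ∷-Join {b = b} b~A (join A′≼A B′≼B lenA lenB joined) =
    join A′≼A (∷-mono-≼ b B′≼B) lenA (cong suc lenB) (All-≼ A′≼A b~A ∷ joined)

  trivial-Join : ∀ {κ} k n {A B} → k * 2 ^ n ≤ length A → Join κ k 0 A B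
  trivial-Join k n large =
    let A′ , A′≼A , lenA = take-≼ k (≤-trans (m≤m*n k (2 ^ n) {{m^n≢0 2 n}}) large)
    in join A′≼A []≼ lenA refl []

  -- Each vertex b of B halves A to its majority neighbourhood and lowers p or s by one. When one of
  -- them reaches 0, at least k vertices of A survive, and they are joined in that colour to every b
  -- counted for it.
  bipartite-ramsey : ∀ {κ κ′} → κ ≢ κ′ → ∀ k p s A B →
                     k * 2 ^ (p + s) ≤ length A → p + s ≤ length B →
                     Join κ k p A B ⊎ Join κ′ k s A B
  bipartite-ramsey κ≢κ′ k zero    s    A B largeA _ = inj₁ (trivial-Join k s largeA)
  bipartite-ramsey κ≢κ′ k (suc p) zero A B largeA _ = inj₂ (trivial-Join k (suc p + 0) largeA)
  bipartite-ramsey κ≢κ′ k (suc p) (suc s) A [] _ ()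
  bipartite-ramsey κ≢κ′ k (suc p) (suc s) A (b ∷ B) largeA largeB
    -- Here b comes from B, so A loses no vertex before it is halved and the extra 1 allowed by
    -- `majority` is given away.
    with majority (χ b) (k * 2 ^ (p + suc s)) A (≤-trans (≤-reflexive halves) (m≤n⇒m≤1+n largeA))
    where
    halves : k * 2 ^ (p + suc s) + k * 2 ^ (p + suc s) ≡ k * 2 ^ (suc p + suc s)
    halves = trans (sym (*-distribˡ-+ k (2 ^ (p + suc s)) (2 ^ (p + suc s))))
                   (cong (k *_) (sym (2^suc (p + suc s))))
  ... | κ″ , A₁ , A₁≼A , large , b~A₁ with two-colours κ≢κ′ κ″
  ...   | inj₁ refl = Sum.map
    (Join-mono A₁≼A ≼-refl ∘ ∷-Join b~A₁)
    (Join-mono A₁≼A (++-≼ʳ (b ∷ [])))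
    (bipartite-ramsey κ≢κ′ k p (suc s) A₁ B large (s≤s⁻¹ largeB))
  ...   | inj₂ refl = Sum.map
    (Join-mono A₁≼A (++-≼ʳ (b ∷ [])))
    (Join-mono A₁≼A ≼-refl ∘ ∷-Join b~A₁)
    (bipartite-ramsey κ≢κ′ k (suc p) s A₁ B
      (≤-trans (≤-reflexive (cong (λ n → k * 2 ^ n) (sym (+-suc p s)))) large)
      (≤-trans (≤-reflexive (sym (+-suc p s))) (s≤s⁻¹ largeB)))

  -- Copies of H and bowties.

  module _ (H : Graph) where

    private
      k L : ℕ
      k = v H
      L = cliqueSize H

    -- Injectivity of f is obtained separately, from `tabulate f` being contained in a list without
    -- repetitions.
    IsCopy : Colour → (Fin k → V) → Set
    IsCopy κ f = ∀ {i j} → Adj H i j → χ (f i) (f j) ≡ κ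

    CopyIn : Colour → List V → Set
    CopyIn κ W = ∃[ f ] tabulate f ≼ W × IsCopy κ f

    Bowtie : List V → Set
    Bowtie W = ∃[ zs ] zs ≼ W × length zs ≤ bowtieSize H × (∀ κ → CopyIn κ zs)

    Bowtie-mono : ∀ {W W′} → W ≼ W′ → Bowtie W → Bowtie W′
    Bowtie-mono W≼W′ (zs , zs≼W , rest) = zs , ≼-trans zs≼W W≼W′ , rest

    -- The κ-coloured copy puts a maximum independent set into b and the other
    -- vertices into a, so that both copies together use only b and v H ∸ α H
    -- vertices of a.
    joined-cliques⇒Bowtie : ∀ {κ κ′} → κ ≢ κ′ → (a b : Fin k → V) →
      (∀ {i j} → i ≢ j → χ (a i) (a j) ≡ κ) → (∀ {i j} → i ≢ j → χ (b i) (b j) ≡ κ′) →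
      (∀ i j → χ (b i) (a j) ≡ κ) → Bowtie (tabulate b ++ tabulate a)
    joined-cliques⇒Bowtie {κ} {κ′} κ≢κ′ a b a-clique b-clique b~a
      with max-independent H
    ... | S , indep , ∣S∣≡α with split-subset S
    ...   | ins , outs , p , ins⊆S , outs⊆∁S , small =
      zs , ++-monoʳ-≼ (tabulate b) a-part , zs-small , copy
      where
      open ≤-Reasoning
      zs : List V
      zs = tabulate b ++ map a outs

      tabulate≡map : (f : Fin k → V) → tabulate f ≡ map f (allFin k)
      tabulate≡map f = sym (map-tabulate id f)

      tabulate↭ : (f : Fin k → V) → tabulate f ↭ map f ins ++ map f outs
      tabulate↭ f = ↭-trans (↭-reflexive (tabulate≡map f))
                      (↭-trans (↭.map⁺ f p) (↭-reflexive (map-++ f ins outs)))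

      a-part : map a outs ≼ tabulate a
      a-part = ≼-trans (++-≼ʳ (map a ins)) (↭⇒≼ (↭-sym (tabulate↭ a)))

      zs-small : length zs ≤ bowtieSize H
      zs-small = begin
        length zs                                ≡⟨ length-++ (tabulate b) ⟩
        length (tabulate b) + length (map a outs) ≡⟨ cong₂ _+_ (length-tabulate b) (length-map a outs) ⟩
        k + length outs                          ≤⟨ +-monoʳ-≤ k small ⟩
        k + (k ∸ ∣ S ∣)                          ≡⟨ cong (λ n → k + (k ∸ n)) ∣S∣≡α ⟩
        k + (k ∸ α H)                            ≡⟨ v+[v∸α]≡bowtieSize H ⟩
        bowtieSize H                             ∎

      mixed : Fin k → V
      mixed i with i ∈? S
      ... | yes _ = b i
      ... | no  _ = a i

      mixed-inside : ∀ {i} → i ∈ S → mixed i ≡ b i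
      mixed-inside {i} i∈S with i ∈? S
      ... | yes _   = refl
      ... | no  i∉S = contradiction i∈S i∉S

      mixed-outside : ∀ {i} → ¬ i ∈ S → mixed i ≡ a i
      mixed-outside {i} i∉S with i ∈? S
      ... | yes i∈S = contradiction i∈S i∉S
      ... | no  _   = refl

      adj⇒≢ : ∀ {i j} → Adj H i j → i ≢ j
      adj⇒≢ adj i≡j = irrefl H i≡j adj

      mixed-copy : IsCopy κ mixed
      mixed-copy {i} {j} adj with i ∈? S | j ∈? S
      ... | yes i∈S | yes j∈S = contradiction adj (indep i j i∈S j∈S)
      ... | yes _   | no  _   = b~a i j
      ... | no  _   | yes _   = trans (χ-sym (a i) (b j)) (b~a j i)
      ... | no  _   | no  _   = a-clique (adj⇒≢ adj)

      mixed≼ : tabulate mixed ≼ zs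
      -- Splitting the vertices by S turns `tabulate mixed` into `map b ins ++ map a outs`, whose
      -- first part is contained in `tabulate b`.
      mixed≼ = ≼-trans (↭⇒≼ (↭-trans (tabulate↭ mixed) (↭-reflexive (cong₂ _++_
                 (map-cong-local (All.map mixed-inside ins⊆S))
                 (map-cong-local (All.map mixed-outside outs⊆∁S))))))
               (++-mono-≼ (≼-trans (++-≼ˡ (map b ins)) (↭⇒≼ (↭-sym (tabulate↭ b)))) ≼-refl)

      copy : ∀ κ″ → CopyIn κ″ zs
      copy κ″ with two-colours κ≢κ′ κ″
      ... | inj₁ refl = mixed , mixed≼ , mixed-copy
      ... | inj₂ refl = b , ++-≼ˡ (tabulate b) , λ adj → b-clique (adj⇒≢ adj)

    Join⇒Bowtie : ∀ {κ κ′} → κ ≢ κ′ → ∀ {A B} → AllPairs (HasColour κ) A →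
                  AllPairs (HasColour κ′) B → Join κ k k A B → Bowtie (A ++ B)
    Join⇒Bowtie κ≢κ′ {A} {B} A-clique B-clique (join {A′} {B′} A′≼A B′≼B lenA lenB joined)
      with enumerate A′ lenA | enumerate B′ lenB
    ... | a , refl | b , refl =
      Bowtie-mono (≼-trans (++-mono-≼ B′≼B A′≼A) (↭⇒≼ (↭.++-comm B A)))
        (joined-cliques⇒Bowtie κ≢κ′ a b
          (AllPairs-tabulate⁻ HasColour-sym (AllPairs-≼ HasColour-sym A′≼A A-clique))
          (AllPairs-tabulate⁻ HasColour-sym (AllPairs-≼ HasColour-sym B′≼B B-clique))
          λ i j → All.tabulate⁻ (All.tabulate⁻ joined i) j)

    -- Large subsets of A and B are joined in the colour of one of the two cliques; the other clique
    -- then receives the independent set of the mixed copy.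
    cliques⇒Bowtie : ∀ {κ κ′} → κ ≢ κ′ → ∀ {A B} →
                     AllPairs (HasColour κ) A → AllPairs (HasColour κ′) B →
                     length A ≡ L → length B ≡ L → Bowtie (A ++ B)
    cliques⇒Bowtie κ≢κ′ {A} {B} A-clique B-clique lenA lenB
      with bipartite-ramsey κ≢κ′ k k k A B
             (≤-trans (m≤m+n _ _) (≤-reflexive (sym lenA)))
             (≤-trans (m≤n+m (k + k) (k * 2 ^ (k + k))) (≤-reflexive (sym lenB)))
    ... | inj₁ J = Join⇒Bowtie κ≢κ′ A-clique B-clique J
    -- The joining edges have the colour of B, so A and B exchange roles.
    ... | inj₂ (join A′≼A B′≼B lenA′ lenB′ joined) =
      Bowtie-mono (↭⇒≼ (↭.++-comm B A)) (Join⇒Bowtie (κ≢κ′ ∘ sym) B-clique A-clique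
        (join B′≼B A′≼A lenB′ lenA′
          (All.map (All.map HasColour-sym) (All-swap joined))))
      where
      All-swap : ∀ {xs ys : List V} {R : V → V → Set} →
                 All (λ y → All (R y) xs) ys → All (λ x → All (λ y → R y x) ys) xs
      All-swap h = All.tabulate λ x∈ → All.tabulate λ y∈ → All.lookup (All.lookup h y∈) x∈

    -- Disjoint monochromatic copies of H.

    -- Disjointness is built in: every further copy is taken from `rest`, the part of the list that
    -- the previous copy leaves over.
    data Copies (κ : Colour) : ℕ → List V → Set where
      none : ∀ {W} → Copies κ zero W
      more : ∀ {q W rest} (f : Fin k → V) → IsCopy κ f → W ↭ tabulate f ++ rest →
             Copies κ q rest → Copies κ (suc q) W

    Copies-mono : ∀ {κ q W W′} → W ≼ W′ → Copies κ q W → Copies κ q W′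
    Copies-mono _ none = none
    Copies-mono (us , p) (more {rest = rest} f copy p′ copies) =
      more f copy (↭-trans p (↭-trans (↭.++⁺ʳ us p′) (↭.++-assoc (tabulate f) rest us)))
        (Copies-mono (us , ↭-refl) copies)

    CopyIn-++-Copies : ∀ {κ q zs W} → CopyIn κ zs → Copies κ q W → Copies κ (suc q) (zs ++ W)
    CopyIn-++-Copies {W = W} (f , (us , p) , copy) copies =
      more f copy (↭-trans (↭.++⁺ʳ W p) (↭.++-assoc (tabulate f) us W))
        (Copies-mono (++-≼ʳ us) copies)

    clique⇒CopyIn : ∀ {κ W} → CliqueIn κ k W → CopyIn κ W
    clique⇒CopyIn (xs , xs≼W , len , clique) with enumerate xs len
    ... | f , refl = f , xs≼W , λ adj → AllPairs-tabulate⁻ HasColour-sym clique λ i≡j → irrefl H i≡j adj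

    shrink : ∀ {κ m n W} → m ≤ n → CliqueIn κ n W → CliqueIn κ m W
    shrink {m = m} m≤n (xs , xs≼W , len , clique)
      with take-≼ m (≤-trans m≤n (≤-reflexive (sym len)))
    ... | ys , ys≼xs , len′ = ys , ≼-trans ys≼xs xs≼W , len′
                            , AllPairs-≼ HasColour-sym ys≼xs clique

    -- While 2^(L + L) vertices remain, Ramsey's theorem yields a clique of size L. In the other
    -- colour it forms a bowtie with A; in the colour κ of A it contains a copy of H, which is
    -- removed.
    extract : ∀ {κ} q {A} W → AllPairs (HasColour κ) A → length A ≡ L →
              q * k + 2 ^ (L + L) ≤ length W → Bowtie (A ++ W) ⊎ Copies κ q W
    extract zero W _ _ _ = inj₂ none
    extract {κ} (suc q) {A} W A-clique lenA large with other-colour κ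
    ... | κ′ , κ≢κ′
      with ramsey κ≢κ′ L L W (≤-trans (m≤n+m (2 ^ (L + L)) (suc q * k)) large)
    ...   | inj₂ (B , B≼W , lenB , B-clique) =
      inj₁ (Bowtie-mono (++-monoʳ-≼ A B≼W) (cliques⇒Bowtie κ≢κ′ A-clique B-clique lenA lenB))
    -- Only v(H) vertices of the clique are used up, which keeps the cost of a copy at v(H).
    ...   | inj₁ clique with clique⇒CopyIn (shrink (v≤cliqueSize H) clique)
    ...     | f , (rest , p) , copy = Sum.map
      (Bowtie-mono (++-monoʳ-≼ A (≼-trans (++-≼ʳ (tabulate f)) (↭⇒≼ (↭-sym p)))))
      (more f copy p)
      (extract q rest A-clique lenA (length-rest (tabulate f) p (≤-reflexive (length-tabulate f))
        (≤-trans (≤-reflexive (sym (+-assoc k (q * k) (2 ^ (L + L))))) large)))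

    -- Induction on q: either no bowtie turns up and `extract` delivers all the copies at once, or a
    -- bowtie is removed at a cost of at most d vertices and the search restarts in the rest with a
    -- fresh clique.
    find-copies : ∀ q W → q * bowtieSize H + ramseySlack H ≤ length W → ∃[ κ ] Copies κ q W
    find-copies zero    W _ = red , none
    find-copies (suc q) W large = uncurry continue monochromatic-clique
      where
      open ≤-Reasoning
      d : ℕ
      d = bowtieSize H

      monochromatic-clique : ∃[ κ ] CliqueIn κ L W
      monochromatic-clique
        with ramsey {red} {blue} (λ ()) L L W
               (≤-trans (m≤n+m (2 ^ (L + L)) L) (≤-trans (m≤n+m (ramseySlack H) (suc q * d)) large))
      ... | inj₁ clique = red  , clique
      ... | inj₂ clique = blue , clique

      continue : ∀ κ → CliqueIn κ L W → ∃[ κ ] Copies κ (suc q) W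
      continue κ (A , (W′ , p) , lenA , A-clique)
        with extract (suc q) W′ A-clique lenA (length-rest A p (≤-reflexive lenA) (begin
          L + (suc q * k + 2 ^ (L + L))  ≡⟨ +-assoc L (suc q * k) (2 ^ (L + L)) ⟨
          L + suc q * k + 2 ^ (L + L)    ≡⟨ cong (_+ 2 ^ (L + L)) (+-comm L (suc q * k)) ⟩
          suc q * k + L + 2 ^ (L + L)    ≡⟨ +-assoc (suc q * k) L (2 ^ (L + L)) ⟩
          suc q * k + ramseySlack H              ≤⟨ +-monoˡ-≤ (ramseySlack H) (*-monoʳ-≤ (suc q) (v≤bowtieSize H)) ⟩
          suc q * d + ramseySlack H              ≤⟨ large ⟩
          length W                       ∎))
      ... | inj₂ copies = κ , Copies-mono (≼-trans (++-≼ʳ A) (↭⇒≼ (↭-sym p))) copies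
      ... | inj₁ (zs , zs≼ , small , copyIn)
        with ≼-trans zs≼ (↭⇒≼ (↭-sym p))
      ...   | rest , p′
        with find-copies q rest (length-rest zs p′ small
               (≤-trans (≤-reflexive (sym (+-assoc d (q * d) (ramseySlack H)))) large))
      ...     | κ″ , copies =
        -- The colour κ″ is known only after the recursive call; the bowtie has a copy of H in
        -- either colour, so it supplies the missing one.
        κ″ , Copies-mono (↭⇒≼ (↭-sym p′)) (CopyIn-++-Copies (copyIn κ″) copies)

    Copies⇒embedding : ∀ {κ q W} → Unique W → Copies κ q W →
      Σ (Fin q → Fin k → V) λ fs → (∀ a i → fs a i List.∈ W) × (∀ a → IsCopy κ (fs a)) ×
        (∀ {a b i j} → fs a i ≡ fs b j → a ≡ b × i ≡ j)
    Copies⇒embedding W! none = (λ ()) , (λ ()) , (λ ()) , λ { {()} }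
    Copies⇒embedding {κ} {suc q} {W} W! (more {rest = rest} f copy p copies)
      with AllPairs-≼ ≢-sym (↭⇒≼ (↭-sym p)) W!
    ... | fr! with Copies⇒embedding (AllPairs-≼ ≢-sym (++-≼ʳ (tabulate f)) fr!) copies
    ...   | gs , gs∈ , gs-copy , gs-inj = fs , fs∈ , fs-copy , fs-inj
      where
      fs : Fin (suc q) → Fin k → V
      fs fzero    = f
      fs (fsuc a) = gs a
      fs∈ : ∀ a i → fs a i List.∈ W
      fs∈ fzero    i = ↭.∈-resp-↭ (↭-sym p) (∈-++⁺ˡ (∈-tabulate⁺ i))
      fs∈ (fsuc a) i = ↭.∈-resp-↭ (↭-sym p) (∈-++⁺ʳ (tabulate f) (gs∈ a i))
      fs-copy : ∀ a → IsCopy κ (fs a)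
      fs-copy fzero    = copy
      fs-copy (fsuc a) = gs-copy a
      f≢gs : ∀ i b j → f i ≢ gs b j
      f≢gs i b j = Unique-++⇒≢ fr! (∈-tabulate⁺ i) (gs∈ b j)
      fs-inj : ∀ {a b i j} → fs a i ≡ fs b j → a ≡ b × i ≡ j
      fs-inj {fzero}  {fzero}  eq = refl , Unique-tabulate⁻ (AllPairs-++⁻ˡ (tabulate f) fr!) eq
      fs-inj {fzero}  {fsuc b} eq = contradiction eq (f≢gs _ b _)
      fs-inj {fsuc a} {fzero}  eq = contradiction (sym eq) (f≢gs _ a _)
      fs-inj {fsuc a} {fsuc b} eq = map₁ (cong fsuc) (gs-inj eq)

-- From embeddings to monochromatic subgraphs of the complete graph.

module _ {n} (c : Colouring n) (G : Graph) {κ} (f : Fin (v G) → Fin n)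
         (f-injective : ∀ {i j} → f i ≡ f j → i ≡ j)
         (f-colour : ∀ {i j} → Adj G i j → colour c (f i) (f j) ≡ κ) where

  private
    image? : ∀ x → Dec (∃[ i ] f i ≡ x)
    image? x = Fin.any? λ i → f i Fin.≟ x

    image : Subset n
    image = Vec.tabulate (does ∘ image?)

    image⁺ : ∀ i → f i ∈ image
    image⁺ i = Vec.lookup⇒[]= (f i) image
      (trans (Vec.lookup∘tabulate (does ∘ image?) (f i)) (dec-true (image? (f i)) (i , refl)))

    image⁻ : ∀ {x} → x ∈ image → ∃[ i ] f i ≡ x
    image⁻ {x} x∈
      with image? x | trans (sym (Vec.lookup∘tabulate (does ∘ image?) x)) (Vec.[]=⇒lookup x∈)
    ... | yes i | _ = i

    copy : Subgraph (K n)
    copy = record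
      { verts    = image
      ; Edge     = λ x y → ∃[ i ] ∃[ j ] f i ≡ x × f j ≡ y × Adj G i j
      ; edge?    = λ x y → Fin.any? λ i → Fin.any? λ j →
                     (f i Fin.≟ x) ×-dec (f j Fin.≟ y) ×-dec adj? G i j
      ; symmᵉ    = λ (i , j , fi≡x , fj≡y , adj) → j , i , fj≡y , fi≡x , symm G adj
      ; edge⇒∈   = λ { (i , _ , refl , _) → image⁺ i }
      ; edge⇒adj = λ { (_ , _ , refl , refl , adj) fi≡fj → irrefl G (f-injective fi≡fj) adj }
      }

    to : Fin ∣ image ∣ → Fin (v G)
    to m = proj₁ (image⁻ (element∈ image m))

    f∘to : ∀ m → f (to m) ≡ element image m
    f∘to m = proj₂ (image⁻ (element∈ image m))

    from : Fin (v G) → Fin ∣ image ∣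
    from i = proj₁ (rank (image⁺ i))

    element∘from : ∀ i → element image (from i) ≡ f i
    element∘from i = proj₂ (rank (image⁺ i))

    copy≅G : ⟦ copy ⟧ ≅ G
    copy≅G = record
      { bijection = mk↔ₛ′ to from
          (λ i → f-injective (trans (f∘to (from i)) (element∘from i)))
          (λ m → element-injective image (trans (element∘from (to m)) (f∘to m)))
      ; adj⇔ = λ m n → mk⇔
          (λ (i , j , fi≡ , fj≡ , adj) → subst₂ (Adj G)
            (f-injective (trans fi≡ (sym (f∘to m)))) (f-injective (trans fj≡ (sym (f∘to n)))) adj)
          (λ adj → to m , to n , f∘to m , f∘to n , adj)
      }

  embedding⇒monochromatic-copy : HasMonochromaticCopy c G
  embedding⇒monochromatic-copy =
    copy , (κ , λ { (_ , _ , refl , refl , adj) → f-colour adj }) , copy≅G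

-- This is the bound R(qH) ≤ qd + C. The q disjoint copies are glued along `remQuot` into one
-- embedding of qH.
copies-unavoidable : ∀ H q (c : Colouring (q * bowtieSize H + ramseySlack H)) →
                     HasMonochromaticCopy c (copies q H)
copies-unavoidable H q c
  with find-copies (colour c) (colour-sym c) H q (allFin _) (≤-reflexive (sym (length-tabulate id)))
... | κ , found
  with Copies⇒embedding (colour c) (colour-sym c) H (Unique.allFin⁺ _) found
...   | fs , _ , fs-copy , fs-inj =
  embedding⇒monochromatic-copy c (copies q H) (λ x → f (remQuot (v H) x))
    (λ {x} {y} eq → let a≡b , i≡j = fs-inj eq in remQuot-injective x y (cong₂ _,_ a≡b i≡j))
    λ {x} {y} → f-colour x y
  where
  f : Fin q × Fin (v H) → Fin (q * bowtieSize H + ramseySlack H)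
  f (a , i) = fs a i

  remQuot-injective : ∀ x y → remQuot {q} (v H) x ≡ remQuot (v H) y → x ≡ y
  remQuot-injective x y eq = trans (sym (Fin.combine-remQuot {q} (v H) x))
    (trans (cong (uncurry combine) eq) (Fin.combine-remQuot {q} (v H) y))

  f-colour : ∀ x y → Adj (copies q H) x y →
             colour c (f (remQuot (v H) x)) (f (remQuot (v H) y)) ≡ κ
  -- Adjacent vertices of qH lie in the same copy, so only colours within one copy matter.
  f-colour x y (same , adj) rewrite same = fs-copy _ adj

-- Counting the edges of qH.

Increasing : ∀ {n} → Fin n × Fin n → Set
Increasing (x , y) = x Fin.< y

∈-edges⁺ : ∀ G {x y} → x Fin.< y → Adj G x y → (x , y) List.∈ edges G
∈-edges⁺ G {x} {y} x<y adj =
  ∈-filter⁺ (λ (i , j) → i Fin.<? j ×-dec adj? G i j)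
    (∈-cartesianProduct⁺ (∈-allFin x) (∈-allFin y)) (x<y , adj)

∈-edges⁻ : ∀ G {x y} → (x , y) List.∈ edges G → x Fin.< y × Adj G x y
∈-edges⁻ G xy∈ =
  proj₂ (∈-filter⁻ (λ (i , j) → i Fin.<? j ×-dec adj? G i j)
    {xs = cartesianProduct (allFin (v G)) (allFin (v G))} xy∈)

edges! : ∀ G → Unique (edges G)
edges! G = Unique.filter⁺ (λ (i , j) → i Fin.<? j ×-dec adj? G i j)
             (Unique.cartesianProduct⁺ (Unique.allFin⁺ (v G)) (Unique.allFin⁺ (v G)))

length-cartesianProductWith : ∀ {A B C : Set} (f : A → B → C) xs ys →
                              length (cartesianProductWith f xs ys) ≡ length xs * length ys
length-cartesianProductWith f []       ys = refl
length-cartesianProductWith f (x ∷ xs) ys = trans (length-++ (map (f x) ys))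
  (cong₂ _+_ (length-map (f x) ys) (length-cartesianProductWith f xs ys))

-- Each edge of H is placed in each of the q copies. Since `combine` is injective and increasing in
-- its second argument, the results are distinct and listed in the right order.
q*e≤e[copies] : ∀ q H → q * e H ≤ e (copies q H)
q*e≤e[copies] q H = begin
  q * e H                       ≡⟨ cong (_* e H) (length-tabulate {n = q} id) ⟨
  length (allFin q) * e H       ≡⟨ length-cartesianProductWith place (allFin q) (edges H) ⟨
  length placed                 ≤⟨ Unique-⊆⇒length≤ placed! placed⊆ ⟩
  e (copies q H)                ∎
  where
  open ≤-Reasoning
  place : Fin q → Fin (v H) × Fin (v H) → Fin (q * v H) × Fin (q * v H)
  place a (i , j) = combine a i , combine a j

  placed : List (Fin (q * v H) × Fin (q * v H))
  placed = cartesianProductWith place (allFin q) (edges H)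

  place-injective : ∀ {a b x y} → place a x ≡ place b y → a ≡ b × x ≡ y
  place-injective {a} {b} {i , j} {i′ , j′} eq =
    Fin.combine-injectiveˡ a i b i′ (cong proj₁ eq) ,
    cong₂ _,_ (Fin.combine-injectiveʳ a i b i′ (cong proj₁ eq))
              (Fin.combine-injectiveʳ a j b j′ (cong proj₂ eq))

  placed! : Unique placed
  placed! = Unique.cartesianProductWith⁺ place place-injective (Unique.allFin⁺ q) (edges! H)

  combine-monoʳ-< : ∀ a {i j : Fin (v H)} → i Fin.< j → combine a i Fin.< combine a j
  combine-monoʳ-< a {i} {j} i<j = begin-strict
    toℕ (combine a i)    ≡⟨ Fin.toℕ-combine a i ⟩
    v H * toℕ a + toℕ i  <⟨ +-monoʳ-< (v H * toℕ a) i<j ⟩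
    v H * toℕ a + toℕ j  ≡⟨ Fin.toℕ-combine a j ⟨
    toℕ (combine a j)    ∎

  placed⊆ : ∀ {xy} → xy List.∈ placed → xy List.∈ edges (copies q H)
  placed⊆ xy∈ with ∈-cartesianProductWith⁻ place (allFin q) (edges H) xy∈
  ... | a , (i , j) , _ , ij∈ , refl with ∈-edges⁻ H ij∈
  ...   | i<j , adj = ∈-edges⁺ (copies q H) (combine-monoʳ-< a i<j) adjacent
    where
    adjacent : Adj (copies q H) (combine a i) (combine a j)
    adjacent =
      trans (cong proj₁ (Fin.remQuot-combine a i)) (cong proj₁ (sym (Fin.remQuot-combine a j))) ,
      subst₂ (Adj H) (cong proj₂ (sym (Fin.remQuot-combine a i)))
                     (cong proj₂ (sym (Fin.remQuot-combine a j))) adj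

-- Counting the edges of a Ramsey chain.

-- The edges of `⟦ S ⟧` are pairs of ranks within S; translated back to vertices of G, edges of
-- different subgraphs become comparable.
subgraphEdges : ∀ {G} → Subgraph G → List (Fin (v G) × Fin (v G))
subgraphEdges S = map (λ (i , j) → element (verts S) i , element (verts S) j) (edges ⟦ S ⟧)

∈-subgraphEdges⁻ : ∀ {G} (S : Subgraph G) {x y} → (x , y) List.∈ subgraphEdges S →
                   x Fin.< y × Edge S x y
∈-subgraphEdges⁻ S xy∈ with ∈-map⁻ _ xy∈
... | _ , ij∈ , refl = let i<j , edge = ∈-edges⁻ ⟦ S ⟧ ij∈ in element-mono-< (verts S) i<j , edge

subgraphEdges! : ∀ {G} (S : Subgraph G) → Unique (subgraphEdges S)
subgraphEdges! S = Unique.map⁺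
  (λ eq → cong₂ _,_ (element-injective (verts S) (cong proj₁ eq))
                    (element-injective (verts S) (cong proj₂ eq)))
  (edges! ⟦ S ⟧)

-- The pairs, their reversals and the diagonal are pairwise disjoint in Fin n × Fin n.
increasing-pairs-bound : ∀ {n} (xys : List (Fin n × Fin n)) → Unique xys →
                         (∀ {xy} → xy List.∈ xys → Increasing xy) →
                         2 * length xys + n ≤ n * n
increasing-pairs-bound {n} xys xys! increasing = begin
  2 * length xys + n                ≡⟨ cong (_+ n) (cong (length xys +_) (+-identityʳ (length xys))) ⟩
  length xys + length xys + n       ≡⟨ +-assoc (length xys) (length xys) n ⟩
  length xys + (length xys + n)     ≡⟨ cong (length xys +_) (cong₂ _+_ (length-map swap xys) length-diagonal) ⟨
  length xys + (length (map swap xys) + length diagonal)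
                                    ≡⟨ cong (length xys +_) (length-++ (map swap xys)) ⟨
  length xys + length (map swap xys ++ diagonal)
                                    ≡⟨ length-++ xys ⟨
  length all                        ≤⟨ Unique-⊆⇒length≤ all! (λ _ → ∈-cartesianProduct⁺ (∈-allFin _) (∈-allFin _)) ⟩
  length (cartesianProduct (allFin n) (allFin n))
                                    ≡⟨ length-cartesianProductWith _,_ (allFin n) (allFin n) ⟩
  length (allFin n) * length (allFin n)
                                    ≡⟨ cong₂ _*_ (length-tabulate {n = n} id) (length-tabulate {n = n} id) ⟩
  n * n                             ∎
  where
  open ≤-Reasoning
  diagonal all : List (Fin n × Fin n)
  diagonal = map (λ x → x , x) (allFin n)
  all      = xys ++ map swap xys ++ diagonal

  length-diagonal : length diagonal ≡ n
  length-diagonal = trans (length-map (λ x → x , x) (allFin n)) (length-tabulate {n = n} id)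

  swapped : ∀ {x y} → (x , y) List.∈ map swap xys → y Fin.< x
  swapped xy∈ with ∈-map⁻ swap xy∈
  ... | _ , yx∈ , refl = increasing yx∈

  equal : ∀ {x y} → (x , y) List.∈ diagonal → x ≡ y
  equal xy∈ with ∈-map⁻ _ xy∈
  ... | _ , _ , refl = refl

  all! : Unique all
  all! = Unique.++⁺ xys!
    (Unique.++⁺ (Unique.map⁺ (cong swap) xys!) (Unique.map⁺ (cong proj₁) (Unique.allFin⁺ n))
      λ { {x , y} (∈swap , ∈diag) → Fin.<-irrefl (sym (equal ∈diag)) (swapped ∈swap) })
    λ { {x , y} (∈xys , ∈rest) → [ (λ ∈swap → Fin.<-asym (increasing ∈xys) (swapped ∈swap))
                                  , (λ ∈diag → Fin.<-irrefl (equal ∈diag) (increasing ∈xys)) ]′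
                                  (∈-++⁻ (map swap xys) ∈rest) }

-- The arithmetic series s + (s + 1) + ... + (s + m - 1), doubled and increased by m to avoid
-- division and subtraction. The start s is general for the sake of the induction.
length-concat-tabulate : ∀ {A : Set} s m (f : Fin m → List A) →
                         (∀ i → length (f i) ≡ s + toℕ i) →
                         2 * length (concat (tabulate f)) + m ≡ m * (s + s + m)
length-concat-tabulate s zero    f len = refl
length-concat-tabulate s (suc m) f len = begin
  2 * length (f fzero ++ rest) + suc m
    ≡⟨ cong (λ l → 2 * l + suc m) (trans (length-++ (f fzero))
         (cong (_+ length rest) (trans (len fzero) (+-identityʳ s)))) ⟩
  2 * (s + length rest) + suc m
    ≡⟨ solve 3 (λ s l m → con 2 :* (s :+ l) :+ (con 1 :+ m) := s :+ s :+ con 1 :+ (con 2 :* l :+ m))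
         refl s (length rest) m ⟩
  s + s + 1 + (2 * length rest + m)
    ≡⟨ cong (s + s + 1 +_) (length-concat-tabulate (suc s) m (f ∘ fsuc)
         (λ i → trans (len (fsuc i)) (+-suc s (toℕ i)))) ⟩
  s + s + 1 + m * (suc s + suc s + m)
    ≡⟨ solve 2 (λ s m → s :+ s :+ con 1 :+ m :* ((con 1 :+ s) :+ (con 1 :+ s) :+ m)
                        := (con 1 :+ m) :* (s :+ s :+ (con 1 :+ m))) refl s m ⟩
  suc m * (s + s + suc m) ∎
  where
  open ≡-Reasoning
  open +-*-Solver
  rest = concat (tabulate (f ∘ fsuc))

-- The links are edge-disjoint, so their 1 + 2 + ... + m edges are distinct edges of K n; this is
-- m(m + 1) ≤ n(n - 1) without subtraction.
chain-edge-bound : ∀ {n} {c : Colouring n} {G} → RamseyChain c G →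
                   e G * suc (e G) + n ≤ n * n
chain-edge-bound {n} {c} {G} chain = ≤-trans (≤-reflexive (cong (_+ n) (sym total)))
  (increasing-pairs-bound chainEdges chainEdges! increasing)
  where
  open RamseyChain chain
  m : ℕ
  m = e G

  linkEdges : Fin m → List (Fin n × Fin n)
  linkEdges i = subgraphEdges (link i)

  chainEdges : List (Fin n × Fin n)
  chainEdges = concat (tabulate linkEdges)

  total : 2 * length chainEdges ≡ m * suc m
  total = +-cancelʳ-≡ m (2 * length chainEdges) (m * suc m) (trans
    -- The series starts at 1, as link i has i + 1 edges.
    (length-concat-tabulate 1 m linkEdges (λ i → trans (length-map _ (edges ⟦ link i ⟧)) (size i)))
    (trans (*-suc m (suc m)) (+-comm m (m * suc m))))

  chainEdges! : Unique chainEdges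
  chainEdges! = Unique.concat⁺ (All.tabulate⁺ (subgraphEdges! ∘ link))
    (AllPairs.tabulate⁺ λ {i} {j} i≢j (∈i , ∈j) → edgeDisjoint i j i≢j
      (proj₂ (∈-subgraphEdges⁻ (link i) ∈i)) (proj₂ (∈-subgraphEdges⁻ (link j) ∈j)))

  increasing : ∀ {xy} → xy List.∈ chainEdges → Increasing xy
  increasing xy∈ with ∈-concat⁻′ (tabulate linkEdges) xy∈
  ... | _ , xy∈i , i∈ with ∈-tabulate⁻ i∈
  ...   | i , refl = proj₁ (∈-subgraphEdges⁻ (link i) xy∈i)

-- If n ≤ m, then m + m² ≤ n² ≤ m², which forces m = 0.
m*[1+m]+n≤n*n⇒m<n : ∀ {m n} → 0 < m → m * suc m + n ≤ n * n → m < n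
m*[1+m]+n≤n*n⇒m<n {m} {n} 0<m h = ≰⇒> λ n≤m → <⇒≱ 0<m (begin
  m  ≤⟨ +-cancelʳ-≤ (m * m) m 0 (begin
    m + m * m      ≡⟨ *-suc m m ⟨
    m * suc m      ≤⟨ m≤m+n (m * suc m) n ⟩
    m * suc m + n  ≤⟨ h ⟩
    n * n          ≤⟨ *-mono-≤ n≤m n≤m ⟩
    m * m          ∎) ⟩
  0  ∎)
  where open ≤-Reasoning

-- Comparison of the two bounds.

-- The edge count of a chain does not depend on the colouring, so any colouring of K t serves to
-- produce one.
monochrome : ∀ n → Colouring n
monochrome n = record { colour = λ _ _ → red ; colour-sym = λ _ _ → refl }

theorem9 : (H : Graph) → .{{_ : NonZero (v H)}} → NoIsolatedVertices H →
    e H > 2 * v H ∸ α H →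
    ∃[ q₀ ] (∀ q → q ≥ q₀ → ∀ r t →
    IsRamseyNumber (copies q H) r →
    IsTargetRamseyNumber (copies q H) t →
    t > r)
-- From q ≥ C the gain of one edge per copy absorbs the constant: qd + C ≤ q(d + 1). The `suc` makes
-- q, and with it the number of edges of qH, positive.
theorem9 H _ e>d = suc (ramseySlack H) , λ q q≥ r t (_ , r-least) (chains , _) →
  let open ≤-Reasoning
      m≥ : q * suc (bowtieSize H) ≤ e (copies q H)
      m≥ = ≤-trans (*-monoʳ-≤ q e>d) (q*e≤e[copies] q H)
      q≤m : q ≤ e (copies q H)
      q≤m = ≤-trans (m≤m*n q (suc (bowtieSize H))) m≥
  in begin-strict
    r                                   ≤⟨ r-least _ (copies-unavoidable H q) ⟩
    q * bowtieSize H + ramseySlack H    ≤⟨ +-monoʳ-≤ (q * bowtieSize H) (<⇒≤ q≥) ⟩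
    q * bowtieSize H + q                ≡⟨ +-comm (q * bowtieSize H) q ⟩
    q + q * bowtieSize H                ≡⟨ *-suc q (bowtieSize H) ⟨
    q * suc (bowtieSize H)              ≤⟨ m≥ ⟩
    e (copies q H)                      <⟨ m*[1+m]+n≤n*n⇒m<n (≤-trans (≤-trans (s≤s z≤n) q≥) q≤m)
                                             (chain-edge-bound (chains (monochrome t))) ⟩
    t                                   ∎
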